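{- Let $n\geq5$ be odd, let $G=\mathrm{Sym}(n)$ (acting on $\{1,\dots,n\}$), let $m:=(n-1)/2$, let $H=\langle (i,i+m)\mid i=1,\dots,m\rangle$, and let $g=(1,2,3,\dots,n)$. Let $\Gamma=\mathrm{Cos}(G,H,g)$. Then $(\Gamma,G)\in\mathcal{OG}(4)$ is basic of quasiprimitive type, and a vertex stabiliser $G_x$ has order $2^{(n-1)/2}$.
   Context: All graphs are finite, simple and undirected. For a group $G$, a proper subgroup $H$ and an element $s\in G$, the coset graph $\mathrm{Cos}(G,H,s)$ is the undirected graph with vertex set $\{Hx\mid x\in G\}$ and with $\{Hx,Hy\}$ an edge if and only if $xy^{ -1}\in HsH$ or $yx^{ -1}\in HsH$; $G$ acts on it by right multiplication. Permutations act on the right (products are read left to right). $\mathcal{OG}(4)$ is the set of pairs $(\Gamma,G)$ where $\Gamma$ is a connected graph of valency $4$ with vertex set $X$, and $G\leq\mathrm{Aut}(\Gamma)$ is transitive on $X$ and on edges, and $\Gamma$ is $G$-oriented: there is a $G$-orbit $\Delta\subset X\times X$, disjoint from $\Delta^*=\{(y,x)\mid (x,y)\in\Delta\}$, such that the edges of $\Gamma$ are exactly the pairs $\{x,y\}$ with $(x,y)\in\Delta$ or $(y,x)\in\Delta$. (For the coset graph, $G\leq\mathrm{Aut}(\Gamma)$ means that the right multiplication action of $G$ is faithful.) A pair $(\Gamma,G)\in\mathcal{OG}(4)$ is basic of quasiprimitive type if $G$ is quasiprimitive on $X$, that is, every nontrivial normal subgroup of $G$ is transitive on $X$. -}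

module Defs where

open import Level using (Level; 0ℓ; _⊔_) renaming (suc to lsuc)
open import Algebra.Bundles using (Group)
import Algebra.Properties.Group as GroupProperties
open import Data.Fin.Base using (Fin; zero; suc; toℕ; fromℕ; inject₁)
open import Data.Fin.Permutation as Perm
  using (Permutation′; _⟨$⟩ʳ_; _∘ₚ_; permutation; transpose)
open import Data.Fin.Relation.Unary.Top
  using (View; view; ‵fromℕ; ‵inject₁; view-fromℕ; view-inject₁)
open import Data.Nat.Base using (ℕ; zero; suc; _+_; _<_)
open import Data.Product.Base using (∃; ∃₂; ∃-syntax; _×_; _,_; proj₁)
open import Data.Sum.Base using (_⊎_)
import Data.Sum.Base as Sum
open import Function.Bundles using (Inverse; _⇔_)
open import Relation.Binary.Bundles using (Setoid)
open import Relation.Binary.Core using (Rel)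
open import Relation.Binary.Definitions using (Symmetric; _Respects_; _Respects₂_)
open import Relation.Binary.Construct.Closure.ReflexiveTransitive using (Star)
open import Relation.Binary.Construct.Union using (_∪_)
import Relation.Binary.Construct.On as On
open import Relation.Binary.PropositionalEquality
  using (_≡_; refl; sym; trans; cong; setoid)
import Relation.Binary.Reasoning.Setoid as SetoidReasoning
open import Relation.Nullary.Negation using (¬_)
open import Relation.Unary using (Pred; _∈_)

private
  variable
    a c e ℓ ℓᵥ p v : Level

HasSize : Setoid a ℓ → ℕ → Set (a ⊔ ℓ)
HasSize S k = Inverse S (setoid (Fin k))

IsFinite : Setoid a ℓ → Set (a ⊔ ℓ)
IsFinite S = ∃ (HasSize S)

subset : (S : Setoid a ℓ) → Pred (Setoid.Carrier S) p → Setoid (a ⊔ p) ℓ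
subset S P = On.setoid S (proj₁ {B = P})

record Subgroup (G : Group c ℓ) (p : Level) : Set (c ⊔ ℓ ⊔ lsuc p) where
  open Group G
  field
    Mem  : Pred Carrier p
    resp : Mem Respects _≈_
    ε∈   : ε ∈ Mem
    ∙∈   : ∀ {x y} → x ∈ Mem → y ∈ Mem → x ∙ y ∈ Mem
    ⁻¹∈  : ∀ {x} → x ∈ Mem → x ⁻¹ ∈ Mem

IsNormal : (G : Group c ℓ) → Subgroup G p → Set (c ⊔ p)
IsNormal G N = ∀ {x} g → x ∈ Mem → ((g ⁻¹ ∙ x) ∙ g) ∈ Mem
  where open Group G
        open Subgroup N

IsNontrivial : (G : Group c ℓ) → Subgroup G p → Set (c ⊔ ℓ ⊔ p)
IsNontrivial G N = ∃[ x ] x ∈ Mem × ¬ x ≈ ε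
  where open Group G
        open Subgroup N

module _ (G : Group c ℓ) where
  open Group G

  data Generated (S : Pred Carrier p) : Pred Carrier (c ⊔ ℓ ⊔ p) where
    gen   : ∀ {x} → x ∈ S → Generated S x
    unit  : Generated S ε
    mul   : ∀ {x y} → Generated S x → Generated S y → Generated S (x ∙ y)
    inv   : ∀ {x} → Generated S x → Generated S (x ⁻¹)
    congr : ∀ {x y} → x ≈ y → Generated S x → Generated S y

  ⟨_⟩ : Pred Carrier p → Subgroup G (c ⊔ ℓ ⊔ p)
  ⟨ S ⟩ = record
    { Mem = Generated S ; resp = congr ; ε∈ = unit ; ∙∈ = mul ; ⁻¹∈ = inv }

-- Undirected, possibly with loops; simplicity is imposed by `Loopless`.
record Graph (v ℓ e : Level) : Set (lsuc (v ⊔ ℓ ⊔ e)) where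
  field
    vertices : Setoid v ℓ
  open Setoid vertices public
    using (_≈_) renaming (Carrier to Vertex)
  field
    _~_    : Rel Vertex e
    ~-sym  : Symmetric _~_
    ~-resp : _~_ Respects₂ _≈_

  Loopless : Set (v ⊔ e)
  Loopless = ∀ x → ¬ x ~ x

  -- Steps along _≈_ are allowed because vertices form a setoid.
  Connected : Set (v ⊔ ℓ ⊔ e)
  Connected = ∀ x y → Star (_≈_ ∪ _~_) x y

  HasValency : ℕ → Set (v ⊔ ℓ ⊔ e)
  HasValency k = ∀ x → HasSize (subset vertices (x ~_)) k

record RightAction (G : Group c ℓ) (X : Setoid v ℓᵥ) : Set (c ⊔ ℓ ⊔ v ⊔ ℓᵥ) where
  private
    module G = Group G
    module X = Setoid X
  infixl 7 _·_
  field
    _·_    : X.Carrier → G.Carrier → X.Carrier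
    ·-cong : ∀ {x y g h} → x X.≈ y → g G.≈ h → (x · g) X.≈ (y · h)
    ·-ε    : ∀ x → (x · G.ε) X.≈ x
    ·-∙    : ∀ x g h → (x · (g G.∙ h)) X.≈ (x · g · h)

module _ {G : Group c ℓ} {X : Setoid v ℓᵥ} (α : RightAction G X) where
  private
    module G = Group G
  open Setoid X
  open RightAction α

  IsFaithful : Set (c ⊔ ℓ ⊔ v ⊔ ℓᵥ)
  IsFaithful = ∀ g → (∀ x → (x · g) ≈ x) → g G.≈ G.ε

  IsTransitive : Set (c ⊔ v ⊔ ℓᵥ)
  IsTransitive = ∀ x y → ∃[ g ] (x · g) ≈ y

  IsTransitiveSubgroup : Subgroup G p → Set (c ⊔ v ⊔ ℓᵥ ⊔ p)
  IsTransitiveSubgroup N = ∀ x y → ∃[ g ] g ∈ Mem × (x · g) ≈ y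
    where open Subgroup N

  IsQuasiprimitive : (p : Level) → Set (c ⊔ ℓ ⊔ v ⊔ ℓᵥ ⊔ lsuc p)
  IsQuasiprimitive p = (N : Subgroup G p) →
    IsNormal G N → IsNontrivial G N → IsTransitiveSubgroup N

  stabiliser : Carrier → Setoid (c ⊔ ℓᵥ) ℓ
  stabiliser x = subset G.setoid (λ g → (x · g) ≈ x)

  PairOrbit : (x y : Carrier) → Rel Carrier (c ⊔ ℓᵥ)
  PairOrbit x y x′ y′ = ∃[ g ] (x · g) ≈ x′ × (y · g) ≈ y′

module _ (Γ : Graph v ℓᵥ e) (G : Group c ℓ) (α : RightAction G (Graph.vertices Γ)) where
  open Graph Γ
  open RightAction α

  ActsByAutomorphisms : Set (c ⊔ v ⊔ e)
  ActsByAutomorphisms = ∀ g x y → x ~ y ⇔ (x · g) ~ (y · g)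

  IsEdgeTransitive : Set (c ⊔ v ⊔ ℓᵥ ⊔ e)
  IsEdgeTransitive = ∀ {x y x′ y′} → x ~ y → x′ ~ y′ →
    ∃[ g ] (((x · g) ≈ x′ × (y · g) ≈ y′) ⊎ ((x · g) ≈ y′ × (y · g) ≈ x′))

  IsOriented : Set (c ⊔ v ⊔ ℓᵥ ⊔ e)
  IsOriented = ∃₂ λ x₀ y₀ → let Δ = PairOrbit α x₀ y₀ in
    (∀ x y → Δ x y → ¬ Δ y x) ×
    (∀ x y → x ~ y ⇔ (Δ x y ⊎ Δ y x))

  -- G ≤ Aut(Γ) is expressed by a faithful action by automorphisms.
  record OG4 : Set (c ⊔ ℓ ⊔ v ⊔ ℓᵥ ⊔ e) where
    field
      finite           : IsFinite vertices
      loopless         : Loopless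
      connected        : Connected
      valency          : HasValency 4
      automorphisms    : ActsByAutomorphisms
      faithful         : IsFaithful α
      vertexTransitive : IsTransitive α
      edgeTransitive   : IsEdgeTransitive
      oriented         : IsOriented

  record IsBasicQuasiprimitive (p : Level) : Set (c ⊔ ℓ ⊔ v ⊔ ℓᵥ ⊔ e ⊔ lsuc p) where
    field
      og4            : OG4
      quasiprimitive : IsQuasiprimitive α p

module _ (G : Group c ℓ) (H : Subgroup G p) where
  open Group G renaming (sym to ≈-sym; trans to ≈-trans; refl to ≈-refl)
  open GroupProperties G
  open Subgroup H
  open SetoidReasoning (Group.setoid G)

  private
    cancel-mid : ∀ x y z → (x ∙ y ⁻¹) ∙ (y ∙ z) ≈ x ∙ z
    cancel-mid x y z = begin
      (x ∙ y ⁻¹) ∙ (y ∙ z)  ≈⟨ assoc x (y ⁻¹) (y ∙ z) ⟩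
      x ∙ (y ⁻¹ ∙ (y ∙ z))  ≈⟨ ∙-congˡ (≈-sym (assoc (y ⁻¹) y z)) ⟩
      x ∙ ((y ⁻¹ ∙ y) ∙ z)  ≈⟨ ∙-congˡ (∙-congʳ (inverseˡ y)) ⟩
      x ∙ (ε ∙ z)           ≈⟨ ∙-congˡ (identityˡ z) ⟩
      x ∙ z                 ∎

    flip-quotient : ∀ x y → (x ∙ y ⁻¹) ⁻¹ ≈ y ∙ x ⁻¹
    flip-quotient x y = begin
      (x ∙ y ⁻¹) ⁻¹      ≈⟨ ⁻¹-anti-homo-∙ x (y ⁻¹) ⟩
      (y ⁻¹) ⁻¹ ∙ x ⁻¹   ≈⟨ ∙-congʳ (⁻¹-involutive y) ⟩
      y ∙ x ⁻¹           ∎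

    translate : ∀ x y g → (x ∙ g) ∙ (y ∙ g) ⁻¹ ≈ x ∙ y ⁻¹
    translate x y g = begin
      (x ∙ g) ∙ (y ∙ g) ⁻¹         ≈⟨ ∙-congˡ (⁻¹-anti-homo-∙ y g) ⟩
      (x ∙ g) ∙ (g ⁻¹ ∙ y ⁻¹)      ≈⟨ ∙-congʳ (∙-congˡ (≈-sym (⁻¹-involutive g))) ⟩
      (x ∙ (g ⁻¹) ⁻¹) ∙ (g ⁻¹ ∙ y ⁻¹) ≈⟨ cancel-mid x (g ⁻¹) (y ⁻¹) ⟩
      x ∙ y ⁻¹                     ∎

  -- An element x stands for the right coset Hx; Hx = Hy iff xy⁻¹ ∈ H.
  rightCosets : Setoid c p
  rightCosets = record
    { Carrier = Carrier
    ; _≈_     = λ x y → (x ∙ y ⁻¹) ∈ Mem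
    ; isEquivalence = record
      { refl  = λ {x} → resp (≈-sym (inverseʳ x)) ε∈
      ; sym   = λ {x} {y} xy → resp (flip-quotient x y) (⁻¹∈ xy)
      ; trans = λ {x} {y} {z} xy yz → resp (cancel-mid x y (z ⁻¹)) (∙∈ xy yz)
      }
    }

  DoubleCoset : Carrier → Pred Carrier (c ⊔ ℓ ⊔ p)
  DoubleCoset s x = ∃₂ λ h k → h ∈ Mem × k ∈ Mem × x ≈ (h ∙ s) ∙ k

  private
    double-resp : ∀ {s x y} → x ≈ y → x ∈ DoubleCoset s → y ∈ DoubleCoset s
    double-resp x≈y (h , k , h∈ , k∈ , eq) =
      h , k , h∈ , k∈ , ≈-trans (≈-sym x≈y) eq

    double-∙ˡ : ∀ {s x h} → h ∈ Mem → x ∈ DoubleCoset s → (h ∙ x) ∈ DoubleCoset s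
    double-∙ˡ {s} {x} {h} h∈ (h′ , k , h′∈ , k∈ , eq) =
      h ∙ h′ , k , ∙∈ h∈ h′∈ , k∈ , (begin
        h ∙ x               ≈⟨ ∙-congˡ eq ⟩
        h ∙ ((h′ ∙ s) ∙ k)  ≈⟨ ≈-sym (assoc h (h′ ∙ s) k) ⟩
        (h ∙ (h′ ∙ s)) ∙ k  ≈⟨ ∙-congʳ (≈-sym (assoc h h′ s)) ⟩
        ((h ∙ h′) ∙ s) ∙ k  ∎)

    double-∙ʳ : ∀ {s x k} → k ∈ Mem → x ∈ DoubleCoset s → (x ∙ k) ∈ DoubleCoset s
    double-∙ʳ {s} {x} {k} k∈ (h , k′ , h∈ , k′∈ , eq) =
      h , k′ ∙ k , h∈ , ∙∈ k′∈ k∈ , ≈-trans (∙-congʳ eq) (assoc (h ∙ s) k′ k)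

    module C = Setoid rightCosets

    double-coset-resp : ∀ {s x x′ y y′} → x C.≈ x′ → y C.≈ y′ →
      (x ∙ y ⁻¹) ∈ DoubleCoset s → (x′ ∙ y′ ⁻¹) ∈ DoubleCoset s
    double-coset-resp {s} {x} {x′} {y} {y′} xx′ yy′ xy =
      double-resp
        (≈-trans (∙-congʳ (cancel-mid x′ x (y ⁻¹))) (cancel-mid x′ y (y′ ⁻¹)))
        (double-∙ʳ yy′ (double-∙ˡ (C.sym {x} {x′} xx′) xy))

  Cos : Carrier → Graph c p (c ⊔ ℓ ⊔ p)
  Cos s = record
    { vertices = rightCosets
    ; _~_      = λ x y → (x ∙ y ⁻¹) ∈ DoubleCoset s ⊎ (y ∙ x ⁻¹) ∈ DoubleCoset s
    ; ~-sym    = Sum.swap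
    ; ~-resp   =
        (λ {x} {y} {z} yz → Sum.map
          (double-coset-resp {s} {x} {x} {y} {z} (C.refl {x}) yz)
          (double-coset-resp {s} {y} {z} {x} {x} yz (C.refl {x})))
      , (λ {x} {y} {z} yz → Sum.map
          (double-coset-resp {s} {y} {z} {x} {x} yz (C.refl {x}))
          (double-coset-resp {s} {x} {x} {y} {z} (C.refl {x}) yz))
    }

  -- (Hx)g = H(xg)
  rightMultiplication : RightAction G rightCosets
  rightMultiplication = record
    { _·_    = _∙_
    ; ·-cong = λ {x} {y} {g} {h} xy g≈h → resp
        (≈-sym (≈-trans (∙-congˡ (⁻¹-cong (∙-congˡ (≈-sym g≈h)))) (translate x y g))) xy
    ; ·-ε    = λ x → ≈⇒C≈ (identityʳ x)
    ; ·-∙    = λ x g h → ≈⇒C≈ (≈-sym (assoc x g h))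
    }
    where
    ≈⇒C≈ : ∀ {x y} → x ≈ y → x C.≈ y
    ≈⇒C≈ {x} {y} x≈y = resp (≈-sym (≈-trans (∙-congʳ x≈y) (inverseʳ y))) ε∈

-- `π ∘ₚ ρ` applies π first, so products are read left to right.
Sym : ℕ → Group 0ℓ 0ℓ
Sym n = record
  { Carrier = Permutation′ n
  ; _≈_     = Perm._≈_
  ; _∙_     = _∘ₚ_
  ; ε       = Perm.id
  ; _⁻¹     = Perm.flip
  ; isGroup = record
    { isMonoid = record
      { isSemigroup = record
        { isMagma = record
          { isEquivalence = record
            { refl  = λ _ → refl
            ; sym   = λ π≈ρ i → sym (π≈ρ i)
            ; trans = λ π≈ρ ρ≈σ i → trans (π≈ρ i) (ρ≈σ i)
            }
          ; ∙-cong = λ {_} {π′} {ρ} π≈π′ ρ≈ρ′ i →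
              trans (cong (ρ ⟨$⟩ʳ_) (π≈π′ i)) (ρ≈ρ′ (π′ ⟨$⟩ʳ i))
          }
        ; assoc = λ _ _ _ _ → refl
        }
      ; identity = (λ _ _ → refl) , (λ _ _ → refl)
      }
    ; inverse = (λ π _ → Perm.inverseʳ π) , (λ π _ → Perm.inverseˡ π)
    ; ⁻¹-cong = λ {π} {ρ} π≈ρ i → trans
        (cong (Perm.flip π ⟨$⟩ʳ_)
          (sym (trans (π≈ρ (Perm.flip ρ ⟨$⟩ʳ i)) (Perm.inverseʳ ρ))))
        (Perm.inverseˡ π)
    }
  }

-- The points 1, …, n are represented by 0, …, n-1 : Fin n, so this is (1,2,…,n).
cycle : ∀ n → Permutation′ n
cycle zero    = Perm.id
cycle (suc k) = permutation next prev next-prev prev-next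
  where
  step : {i : Fin (suc k)} → View i → Fin (suc k)
  step ‵fromℕ       = zero
  step (‵inject₁ i) = suc i

  next prev : Fin (suc k) → Fin (suc k)
  next i       = step (view i)
  prev zero    = fromℕ k
  prev (suc i) = inject₁ i

  next-prev : ∀ i → next (prev i) ≡ i
  next-prev zero    = cong step (view-fromℕ k)
  next-prev (suc i) = cong step (view-inject₁ i)

  prev-step : {i : Fin (suc k)} (w : View i) → prev (step w) ≡ i
  prev-step ‵fromℕ       = refl
  prev-step (‵inject₁ i) = refl

  prev-next : ∀ i → prev (next i) ≡ i
  prev-next i = prev-step (view i)

-- toℕ i < m matches 1 ≤ i ≤ m, because points are numbered from 0.
Swaps : ∀ n → ℕ → Pred (Permutation′ n) 0ℓ
Swaps n m π = ∃₂ λ (i j : Fin n) →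
  toℕ i < m × toℕ j ≡ toℕ i + m × π Perm.≈ transpose i j

-- A permutation preserves the blocks {a, a + m} (a < m) and {2m} of the points
-- 0, …, 2m exactly when it is a product of the m commuting swaps, so H is the
-- stabiliser of this partition and has order 2^m. Conjugation by g breaks only
-- one pair, so HgH and Hg⁻¹H each consist of two right cosets of H. As H fixes
-- 2m, the image of 2m separates these four cosets: it is 0 or m on HgH, and
-- 2m - 1 or m - 1 on Hg⁻¹H. The conjugates of (0, m) under powers of g generate
-- Sym(n), whence connectedness. All transpositions are congruent modulo a
-- nontrivial normal subgroup N, and H contains one, so HN = Sym(n).

module Submission where

open import Defs
open import Level using (Level; 0ℓ; _⊔_)
open import Algebra.Bundles using (Group)
import Algebra.Properties.Group as GroupProperties
open import Data.Fin.Base as Fin using (Fin; zero; suc; toℕ; punchIn; remQuot; combine)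
open import Data.Fin.Patterns using (0F; 1F; 2F; 3F)
open import Data.Fin.Permutation as Perm
  using (Permutation′; _⟨$⟩ʳ_; _⟨$⟩ˡ_; _∘ₚ_; transpose; flip; insert; remove; inverseˡ; inverseʳ)
import Data.Fin.Permutation.Components as Components
open import Data.Fin.Permutation.Transposition.List using (eval; decompose; eval-decompose)
import Data.Fin.Properties as Fin
open import Data.Fin.Properties using (_≟_; all?; toℕ<n; toℕ-injective; ¬∀⟶∃¬; pigeonhole)
open import Data.List.Base
  using (List; []; _∷_; deduplicate; length; lookup; cartesianProductWith; allFin)
import Data.List.Membership.DecPropositional as DecMembership
open import Data.List.Membership.Propositional using (_∉_)
open import Data.List.Membership.Propositional.Properties using (∈-allFin; ∈-lookup)
import Data.List.Membership.Setoid.Properties as Membership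
open import Data.List.Relation.Unary.All as All using ()
open import Data.List.Relation.Unary.AllPairs using (_∷_)
open import Data.List.Relation.Unary.Any as Any using (here; there; index)
open import Data.List.Relation.Unary.Any.Properties using (lookup-index)
open import Data.List.Relation.Unary.Enumerates.Setoid using (IsEnumeration)
import Data.List.Relation.Unary.Enumerates.Setoid.Properties as Enumerates
open import Data.List.Relation.Unary.Unique.DecSetoid.Properties using (deduplicate-!)
open import Data.List.Relation.Unary.Unique.Setoid using (Unique)
open import Data.Nat.Base as ℕ
  using (ℕ; zero; suc; _+_; _*_; _∸_; _^_; _≤_; _<_; z≤n; s≤s; s<s; z<s; s≤s⁻¹)
open import Data.Nat.DivMod
  using (_/_; _%_; _mod_; m<n⇒m%n≡m; m≡m%n+[m/n]*n; m*n/n≡m; /-monoˡ-≤)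
import Data.Nat.Properties as ℕ
open import Data.Product.Base using (∃-syntax; _×_; _,_; proj₁; proj₂)
open import Data.Sum.Base as Sum using (_⊎_; inj₁; inj₂)
open import Function.Base using (_∘_)
open import Function.Bundles using (Injection; mk⇔)
open import Function.Properties.Inverse using (↔⇒↣)
open import Relation.Binary.Bundles using (Setoid; DecSetoid)
open import Relation.Binary.Construct.Closure.ReflexiveTransitive
  using (Star; ε; _◅_; _◅◅_; reverse)
open import Relation.Binary.Definitions using (tri<; tri≈; tri>)
open import Relation.Binary.PropositionalEquality
  using (_≡_; _≢_; refl; sym; trans; cong; cong₂; subst; subst₂; ≢-sym)
  renaming (setoid to ≡-setoid)
import Relation.Binary.Reasoning.Setoid as SetoidReasoning
open import Relation.Nullary using (Dec; yes; no)
open import Relation.Nullary.Decidable as Dec using (dec-true; dec-false)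
open import Relation.Nullary.Negation using (¬_; contradiction)
open import Relation.Unary using (Pred; _∈_; _⊆_)

private
  variable
    c ℓ ℓᵥ p q v : Level
    n : ℕ
    i j k l : Fin n
    π ρ : Permutation′ n

-- Finite setoids

module _ (S : Setoid c ℓ) where
  open Setoid S using (Carrier; _≈_)
  private
    module S = Setoid S

  hasSize : ∀ {k} (f : Fin k → Carrier) →
    (∀ {a b} → f a ≈ f b → a ≡ b) → (∀ x → ∃[ a ] x ≈ f a) → HasSize S k
  hasSize f injective surjective = record
    { to        = proj₁ ∘ surjective
    ; from      = f
    ; to-cong   = λ x≈y → injective (S.trans (S.sym (preimage _)) (S.trans x≈y (preimage _)))
    ; from-cong = λ { refl → S.refl }
    ; inverse   = (λ y≈fa → injective (S.trans (S.sym (preimage _)) y≈fa))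
                , (λ { refl → S.sym (preimage _) })
    }
    where
    preimage : ∀ x → x ≈ f (proj₁ (surjective x))
    preimage x = proj₂ (surjective x)

  lookup-injective : ∀ {xs : List Carrier} → Unique S xs →
    ∀ {i j} → lookup xs i ≈ lookup xs j → i ≡ j
  lookup-injective (x∉xs ∷ xs!) {zero} {zero} _ = refl
  lookup-injective {_ ∷ xs} (x∉xs ∷ xs!) {zero} {suc j} eq =
    contradiction eq (All.lookup x∉xs (∈-lookup {xs = xs} j))
  lookup-injective {_ ∷ xs} (x∉xs ∷ xs!) {suc i} {zero} eq =
    contradiction (S.sym eq) (All.lookup x∉xs (∈-lookup {xs = xs} i))
  lookup-injective (x∉xs ∷ xs!) {suc i} {suc j} eq = cong suc (lookup-injective xs! eq)

-- An enumeration may repeat elements up to equivalence; deduplication by the decidable equality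
-- leaves one representative of each class.
enumerated⇒finite : (S : DecSetoid c ℓ) {xs : List (DecSetoid.Carrier S)} →
  IsEnumeration (DecSetoid.setoid S) xs → IsFinite (DecSetoid.setoid S)
enumerated⇒finite S {xs} enumerates = length ys , hasSize setoid (lookup ys)
  (lookup-injective setoid (deduplicate-! S xs))
  (λ x → let x∈ys = Enumerates.deduplicate⁺ S enumerates x in index x∈ys , lookup-index x∈ys)
  where
  open DecSetoid S using (setoid)
  ys = deduplicate (DecSetoid._≟_ S) xs

-- Group actions and orbits of ordered pairs

module _ {G : Group c ℓ} {X : Setoid v ℓᵥ} (α : RightAction G X) where
  private
    module G = Group G
    module X = Setoid X
  open Setoid X using (_≈_)
  open RightAction α

  ·-⁻¹ : ∀ {x y g} → x · g ≈ y → y · g G.⁻¹ ≈ x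
  ·-⁻¹ {x} {y} {g} xg≈y = X.trans (·-cong (X.sym xg≈y) G.refl)
    (X.trans (X.sym (·-∙ x g (g G.⁻¹))) (X.trans (·-cong X.refl (G.inverseʳ g)) (·-ε x)))

  -- Compose the inverse of the element reaching `(x , y)` with the element reaching `(x′ , y′)`.
  PairOrbit-euclidean : ∀ {a b x y x′ y′} →
    PairOrbit α a b x y → PairOrbit α a b x′ y′ → PairOrbit α x y x′ y′
  PairOrbit-euclidean (g , ag≈x , bg≈y) (h , ah≈x′ , bh≈y′) =
    g G.⁻¹ G.∙ h , move ag≈x ah≈x′ , move bg≈y bh≈y′
    where
    move : ∀ {a x x′} → a · g ≈ x → a · h ≈ x′ → x · (g G.⁻¹ G.∙ h) ≈ x′
    move ag≈x ah≈x′ = X.trans (·-∙ _ _ _) (X.trans (·-cong (·-⁻¹ ag≈x) G.refl) ah≈x′)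

-- Coset graphs of arbitrary groups

module CosetGraph (G : Group c ℓ) (H : Subgroup G p) (s : Group.Carrier G) where
  open Group G hiding (refl; inverseʳ) renaming (ε to 1#; sym to ≈-sym; trans to ≈-trans)
  open GroupProperties G
  open Subgroup H
  open SetoidReasoning setoid
  open Graph (Cos G H s) using (_~_)

  private
    module G = Group G
    module C = Setoid (rightCosets G H)
    α = rightMultiplication G H

  ∈D-resp : ∀ {x y} → x ≈ y → x ∈ DoubleCoset G H s → y ∈ DoubleCoset G H s
  ∈D-resp x≈y (h , k , h∈ , k∈ , eq) = h , k , h∈ , k∈ , ≈-trans (≈-sym x≈y) eq

  ≈⇒C≈ : ∀ {x y} → x ≈ y → x C.≈ y
  ≈⇒C≈ x≈y = resp (≈-sym (x≈y⇒x∙y⁻¹≈ε x≈y)) ε∈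

  ∈H⇒C≈ : ∀ {h} → h ∈ Mem → ∀ x → (h ∙ x) C.≈ x
  ∈H⇒C≈ {h} h∈H x = resp (≈-sym (//-rightDividesʳ x h)) h∈H

  s∈D : s ∈ DoubleCoset G H s
  s∈D = 1# , 1# , ε∈ , ε∈ , ≈-sym (≈-trans (identityʳ _) (identityˡ s))

  translate : ∀ x y g → (x ∙ g) // (y ∙ g) ≈ x // y
  translate x y g = begin
    (x ∙ g) ∙ (y ∙ g) ⁻¹      ≈⟨ ∙-congˡ (⁻¹-anti-homo-∙ y g) ⟩
    (x ∙ g) ∙ (g ⁻¹ ∙ y ⁻¹)   ≈⟨ assoc _ _ _ ⟨
    ((x ∙ g) ∙ g ⁻¹) ∙ y ⁻¹   ≈⟨ ∙-congʳ (//-rightDividesʳ g x) ⟩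
    x // y                    ∎

  -- If x y⁻¹ = h s k, then k y moves the base pair (Hs, H) to (Hx, Hy). With the converse
  -- `orbit⇒arc`, the arcs form a single orbit of ordered pairs.
  arc⇒orbit : ∀ {x y} → x // y ∈ DoubleCoset G H s → PairOrbit α s 1# x y
  arc⇒orbit {x} {y} (h , k , h∈ , k∈ , eq) = k ∙ y
    , C.sym {x} {s ∙ (k ∙ y)} (C.trans {x} {h ∙ (s ∙ (k ∙ y))} (≈⇒C≈ x≈) (∈H⇒C≈ h∈ _))
    , C.trans {1# ∙ (k ∙ y)} (≈⇒C≈ (identityˡ _)) (∈H⇒C≈ k∈ y)
    where
    x≈ : x ≈ h ∙ (s ∙ (k ∙ y))
    x≈ = begin
      x                     ≈⟨ //-rightDividesˡ y x ⟨
      (x // y) ∙ y          ≈⟨ ∙-congʳ eq ⟩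
      ((h ∙ s) ∙ k) ∙ y     ≈⟨ assoc _ _ _ ⟩
      (h ∙ s) ∙ (k ∙ y)     ≈⟨ assoc _ _ _ ⟩
      h ∙ (s ∙ (k ∙ y))     ∎

  orbit⇒arc : ∀ {x y} → PairOrbit α s 1# x y → x // y ∈ DoubleCoset G H s
  orbit⇒arc {x} {y} (z , sz≈x , z≈y) =
    x // (s ∙ z) , (1# ∙ z) // y , C.sym {s ∙ z} {x} sz≈x , z≈y , (begin
      x // y                                   ≈⟨ ∙-congʳ (//-rightDividesˡ (s ∙ z) x) ⟨
      ((x // (s ∙ z)) ∙ (s ∙ z)) // y          ≈⟨ ∙-congʳ (assoc _ _ _) ⟨
      (((x // (s ∙ z)) ∙ s) ∙ z) // y          ≈⟨ assoc _ _ _ ⟩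
      ((x // (s ∙ z)) ∙ s) ∙ (z // y)          ≈⟨ ∙-congˡ (∙-congʳ (identityˡ z)) ⟨
      ((x // (s ∙ z)) ∙ s) ∙ ((1# ∙ z) // y)   ∎)

  vertexTransitive : IsTransitive α
  vertexTransitive x y = x ⁻¹ ∙ y , ≈⇒C≈ (\\-leftDividesˡ x y)

  automorphisms : ActsByAutomorphisms (Cos G H s) G α
  automorphisms g x y = mk⇔
    (Sum.map (∈D-resp (≈-sym (translate x y g))) (∈D-resp (≈-sym (translate y x g))))
    (Sum.map (∈D-resp (translate x y g)) (∈D-resp (translate y x g)))

  -- Every edge, in one of its two directions, lies in the orbit of (Hs, H); the four cases say
  -- which directions these are.
  edgeTransitive : IsEdgeTransitive (Cos G H s) G α
  edgeTransitive {x} {y} {x′} {y′} x~y x′~y′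
    with Sum.map arc⇒orbit arc⇒orbit x~y | Sum.map arc⇒orbit arc⇒orbit x′~y′
  ... | inj₁ xy | inj₁ x′y′ =
    let g , xx′ , yy′ = PairOrbit-euclidean α {x = x} {y} {x′} {y′} xy x′y′ in g , inj₁ (xx′ , yy′)
  ... | inj₁ xy | inj₂ y′x′ =
    let g , xy′ , yx′ = PairOrbit-euclidean α {x = x} {y} {y′} {x′} xy y′x′ in g , inj₂ (xy′ , yx′)
  ... | inj₂ yx | inj₁ x′y′ =
    let g , yx′ , xy′ = PairOrbit-euclidean α {x = y} {x} {x′} {y′} yx x′y′ in g , inj₂ (xy′ , yx′)
  ... | inj₂ yx | inj₂ y′x′ =
    let g , yy′ , xx′ = PairOrbit-euclidean α {x = y} {x} {y′} {x′} yx y′x′ in g , inj₁ (xx′ , yy′)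

  -- Reversing an arc inverts x y⁻¹, so the orbit of arcs is disjoint from its reverse once no
  -- element of HsH has its inverse there.
  oriented : (∀ u → u ∈ DoubleCoset G H s → ¬ u ⁻¹ ∈ DoubleCoset G H s) → IsOriented (Cos G H s) G α
  oriented antisym = s , 1#
    , (λ x y xy yx → antisym (x // y) (orbit⇒arc xy)
        (∈D-resp (≈-sym (⁻¹-anti-homo-// x y)) (orbit⇒arc yx)))
    , (λ x y → mk⇔ (Sum.map arc⇒orbit arc⇒orbit) (Sum.map orbit⇒arc orbit⇒arc))

  loopless : ¬ 1# ∈ DoubleCoset G H s → Graph.Loopless (Cos G H s)
  loopless 1∉D x = Sum.[ 1∉D ∘ ∈D-resp (G.inverseʳ x) , 1∉D ∘ ∈D-resp (G.inverseʳ x) ]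

  -- The elements k such that every Hx is joined to Hkx form a subgroup containing H and s. Once
  -- this is the whole group, k = y x⁻¹ joins Hx to Hy.
  connected : (∀ (K : Subgroup G (c ⊔ ℓ ⊔ p)) → Mem ⊆ Subgroup.Mem K → s ∈ Subgroup.Mem K →
      ∀ x → x ∈ Subgroup.Mem K) →
    Graph.Connected (Cos G H s)
  connected generates x y =
    generates reachable (λ h∈ x → inj₁ (C.sym {_ ∙ x} {x} (∈H⇒C≈ h∈ x)) ◅ ε)
      (λ x → inj₂ (inj₂ (∈D-resp (≈-sym (//-rightDividesʳ x s)) s∈D)) ◅ ε) (y // x) x
    ◅◅ jump (//-rightDividesˡ x y)
    where
    Walk = Star λ x y → (x C.≈ y) ⊎ (x ~ y)
    jump : ∀ {x y} → x ≈ y → Walk x y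
    jump x≈y = inj₁ (≈⇒C≈ x≈y) ◅ ε
    reachable : Subgroup G (c ⊔ ℓ ⊔ p)
    reachable = record
      { Mem  = λ k → ∀ x → Walk x (k ∙ x)
      ; resp = λ k≈k′ walk x → walk x ◅◅ jump (∙-congʳ k≈k′)
      ; ε∈   = λ x → jump (≈-sym (identityˡ x))
      ; ∙∈   = λ {k} {k′} walk walk′ x → walk′ x ◅◅ walk (k′ ∙ x) ◅◅ jump (≈-sym (assoc k k′ x))
      -- The walk from k⁻¹ x to k k⁻¹ x = x, reversed; it exists because membership quantifies over
      -- all starting points.
      ; ⁻¹∈  = λ {k} walk x → jump (≈-sym (\\-leftDividesˡ k x))
                 ◅◅ reverse (λ {x} {y} → Sum.map (C.sym {x} {y}) Sum.swap) (walk (k ⁻¹ ∙ x))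
      }

-- Enumeration of Sym(n)

perm-injective : (π : Permutation′ n) → π ⟨$⟩ʳ i ≡ π ⟨$⟩ʳ j → i ≡ j
perm-injective π = Injection.injective (↔⇒↣ π)

insert-cong : ∀ i j → π Perm.≈ ρ → insert i j π Perm.≈ insert i j ρ
insert-cong i j π≈ρ k with i ≟ k
... | yes _ = refl
... | no  _ = cong (punchIn j) (π≈ρ _)

permutations : ∀ n → List (Permutation′ n)
permutations zero    = Perm.id ∷ []
permutations (suc n) = cartesianProductWith (insert zero) (allFin (suc n)) (permutations n)

-- A permutation is recovered from the image of `zero` and the permutation left after removing
-- `zero`.
permutations-enumerates : ∀ n → IsEnumeration (Group.setoid (Sym n)) (permutations n)
permutations-enumerates zero    π = here λ ()
permutations-enumerates (suc n) π =
  Any.map (λ eq i → trans (sym (Perm.insert-remove zero π i)) (eq i))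
    (Membership.∈-cartesianProductWith⁺ (≡-setoid _)
      (Group.setoid (Sym n)) (Group.setoid (Sym (suc n)))
      (λ { {i} {_} {π} {ρ} refl π≈ρ → insert-cong {π = π} {ρ} zero i π≈ρ })
      (∈-allFin (π ⟨$⟩ʳ zero)) (permutations-enumerates n (remove zero π)))

-- Otherwise the position of each point in `is` would inject `Fin n` into the fewer positions of the
-- list.
avoid : (is : List (Fin n)) → length is ℕ.< n → ∃[ k ] k ∉ is
avoid {n} is short = ¬∀⟶∃¬ n (λ k → Any.Any (k ≡_) is) (λ k → DecMembership._∈?_ _≟_ k is) λ all∈ →
  let i , j , i<j , eq = pigeonhole short (index ∘ all∈)
  in Fin.<⇒≢ i<j (Membership.index-injective (≡-setoid _) (all∈ i) (all∈ j) eq)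

-- Transpositions

transpose-left : (i j : Fin n) → transpose i j ⟨$⟩ʳ i ≡ j
transpose-left i j rewrite dec-true (i ≟ i) refl = refl

transpose-right : (i j : Fin n) → transpose i j ⟨$⟩ʳ j ≡ i
transpose-right i j with j ≟ i
... | yes j≡i = j≡i
... | no  _   rewrite dec-true (j ≟ j) refl = refl

transpose-fix : k ≢ i → k ≢ j → transpose i j ⟨$⟩ʳ k ≡ k
transpose-fix {k = k} {i} {j} k≢i k≢j rewrite dec-false (k ≟ i) k≢i | dec-false (k ≟ j) k≢j = refl

transpose-unique : π ⟨$⟩ʳ i ≡ j → π ⟨$⟩ʳ j ≡ i → (∀ k → k ≢ i → k ≢ j → π ⟨$⟩ʳ k ≡ k) →
  π Perm.≈ transpose i j
transpose-unique {π = π} {i} {j} i↦j j↦i fix k = go (k ≟ i) (k ≟ j)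
  where
  go : Dec (k ≡ i) → Dec (k ≡ j) → π ⟨$⟩ʳ k ≡ transpose i j ⟨$⟩ʳ k
  go (yes refl) _          = trans i↦j (sym (transpose-left k j))
  go (no _)     (yes refl) = trans j↦i (sym (transpose-right i k))
  go (no k≢i)   (no k≢j)   = trans (fix k k≢i k≢j) (sym (transpose-fix k≢i k≢j))

transpose-comm : (i j : Fin n) → transpose i j Perm.≈ transpose j i
transpose-comm i j = transpose-unique {π = transpose i j}
  (transpose-right i j) (transpose-left i j) (λ k k≢j k≢i → transpose-fix k≢i k≢j)

transpose-refl : (i : Fin n) → Perm.id Perm.≈ transpose i i
transpose-refl i = transpose-unique {π = Perm.id} refl refl (λ _ _ _ → refl)

transpose-involutive : (i j k : Fin n) → transpose i j ⟨$⟩ʳ (transpose i j ⟨$⟩ʳ k) ≡ k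
transpose-involutive i j k =
  trans (cong (transpose i j ⟨$⟩ʳ_) (transpose-comm i j k)) (Components.transpose-inverse i j)

transpose-conj : (π : Permutation′ n) (i j : Fin n) →
  (flip π ∘ₚ transpose i j) ∘ₚ π Perm.≈ transpose (π ⟨$⟩ʳ i) (π ⟨$⟩ʳ j)
transpose-conj π i j = transpose-unique {π = (flip π ∘ₚ transpose i j) ∘ₚ π}
  (cong (π ⟨$⟩ʳ_) (trans (cong (transpose i j ⟨$⟩ʳ_) (inverseˡ π)) (transpose-left i j)))
  (cong (π ⟨$⟩ʳ_) (trans (cong (transpose i j ⟨$⟩ʳ_) (inverseˡ π)) (transpose-right i j)))
  (λ k k≢πi k≢πj → trans
    (cong (π ⟨$⟩ʳ_) (transpose-fix
      (λ { refl → k≢πi (sym (inverseʳ π)) })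
      (λ { refl → k≢πj (sym (inverseʳ π)) })))
    (inverseʳ π))

-- Transpositions lying in a subgroup

module _ (K : Subgroup (Sym n) p) where
  open Subgroup K

  ∈-conj : π ∈ Mem → ρ ∈ Mem → (flip π ∘ₚ ρ) ∘ₚ π ∈ Mem
  ∈-conj π∈ ρ∈ = ∙∈ (∙∈ (⁻¹∈ π∈) ρ∈) π∈

  -- An equivalence relation on points, invariant under `K`. It is reflexive because `transpose i i`
  -- is the identity.
  Transposes : (i j : Fin n) → Set p
  Transposes i j = transpose i j ∈ Mem

  Transposes-refl : ∀ i → Transposes i i
  Transposes-refl i = resp (transpose-refl i) ε∈

  Transposes-sym : Transposes i j → Transposes j i
  Transposes-sym {i} {j} = resp (transpose-comm i j)

  Transposes-map : π ∈ Mem → Transposes i j → Transposes (π ⟨$⟩ʳ i) (π ⟨$⟩ʳ j)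
  Transposes-map {π} {i} {j} π∈ ij∈ = resp (transpose-conj π i j) (∈-conj π∈ ij∈)

  -- If i differs from j and k, conjugating (i j) by (j k) gives (i k).
  Transposes-trans : Transposes i j → Transposes j k → Transposes i k
  Transposes-trans {i} {j} {k} ij jk with i ≟ j | i ≟ k
  ... | yes refl | _        = jk
  ... | no  _    | yes refl = Transposes-refl i
  ... | no  i≢j  | no  i≢k  =
    subst₂ Transposes (transpose-fix i≢j i≢k) (transpose-left j k) (Transposes-map jk ij)

  transpositions-generate : (∀ i j → Transposes i j) → ∀ π → π ∈ Mem
  transpositions-generate transposes π = resp (eval-decompose π) (eval∈ (decompose π))
    where
    eval∈ : ∀ ts → eval ts ∈ Mem
    eval∈ []             = ε∈
    eval∈ ((i , j) ∷ ts) = ∙∈ (transposes i j) (eval∈ ts)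

-- Congruence modulo a normal subgroup of Sym(n)

-- Modulo a normal subgroup N that moves i to j ≢ i, conjugate transpositions
-- (i k) and (j l) agree; a fifth point then identifies two transpositions
-- sharing exactly one point, and 3-transitivity identifies all of them.
module NormalSubgroup {n : ℕ} (5≤n : 5 ≤ n) (N : Subgroup (Sym n) p)
  (normal : IsNormal (Sym n) N) (nontrivial : IsNontrivial (Sym n) N) where
  open Subgroup N
  private
    x  = proj₁ nontrivial
    x∈ = proj₁ (proj₂ nontrivial)
    module Mod = Setoid (rightCosets (Sym n) N)

  infix 4 _≋_
  _≋_ : Permutation′ n → Permutation′ n → Set p
  _≋_ = Mod._≈_

  ≋-conj : ∀ g {s t} → s ≋ t → (flip g ∘ₚ s) ∘ₚ g ≋ (flip g ∘ₚ t) ∘ₚ g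
  ≋-conj g {s} {t} st∈ =
    resp (λ i → cong (λ j → g ⟨$⟩ʳ (t ⟨$⟩ˡ j)) (sym (inverseˡ g))) (normal g st∈)

  -- t (x⁻¹ t x)⁻¹ = (t x⁻¹ t⁻¹) x is the product of a conjugate of x⁻¹ and x.
  ≋-conj-member : ∀ {x} → x ∈ Mem → ∀ t → t ≋ (flip x ∘ₚ t) ∘ₚ x
  ≋-conj-member {x} x∈ t = resp (λ _ → refl) (∙∈ (normal (flip t) (⁻¹∈ x∈)) x∈)

  -- s t (s′ t′)⁻¹ = (s s′⁻¹) (s′ (t t′⁻¹) s′⁻¹), so normality lets congruences be multiplied.
  ≋-∘ : ∀ {s s′ t t′} → s ≋ s′ → t ≋ t′ → s ∘ₚ t ≋ s′ ∘ₚ t′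
  ≋-∘ {s} {s′} {t} {t′} s≋s′ t≋t′ =
    resp (λ i → cong (λ j → s′ ⟨$⟩ˡ (t′ ⟨$⟩ˡ (t ⟨$⟩ʳ j))) (inverseʳ s′))
      (∙∈ s≋s′ (normal (flip s′) t≋t′))

  ≈⇒≋ : ∀ {s t} → s Perm.≈ t → s ≋ t
  ≈⇒≋ {s} {t} = CosetGraph.≈⇒C≈ (Sym n) N Perm.id {s} {t}

  infix 4 _~_
  _~_ : Fin n × Fin n → Fin n × Fin n → Set p
  (i , j) ~ (k , l) = transpose i j ≋ transpose k l

  ~-sym : (i , j) ~ (k , l) → (k , l) ~ (i , j)
  ~-sym {i} {j} {k} {l} = Mod.sym {transpose i j} {transpose k l}

  ~-trans : ∀ {i′ j′} → (i , j) ~ (k , l) → (k , l) ~ (i′ , j′) → (i , j) ~ (i′ , j′)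
  ~-trans {i} {j} {k} {l} {i′} {j′} = Mod.trans {transpose i j} {transpose k l} {transpose i′ j′}

  ~-swap : (i , j) ~ (j , i)
  ~-swap {i} {j} = ≈⇒≋ {transpose i j} {transpose j i} (transpose-comm i j)

  ~-map : ∀ g → (i , j) ~ (k , l) → (g ⟨$⟩ʳ i , g ⟨$⟩ʳ j) ~ (g ⟨$⟩ʳ k , g ⟨$⟩ʳ l)
  ~-map {i} {j} {k} {l} g eq =
    Mod.trans {gᵢⱼ} {conjugate (transpose i j)} {gₖₗ}
      (Mod.sym {conjugate (transpose i j)} {gᵢⱼ}
        (≈⇒≋ {conjugate (transpose i j)} {gᵢⱼ} (transpose-conj g i j)))
      (Mod.trans {conjugate (transpose i j)} {conjugate (transpose k l)} {gₖₗ}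
        (≋-conj g {transpose i j} {transpose k l} eq)
        (≈⇒≋ {conjugate (transpose k l)} {gₖₗ} (transpose-conj g k l)))
    where
    conjugate = λ t → (flip g ∘ₚ t) ∘ₚ g
    gᵢⱼ = transpose (g ⟨$⟩ʳ i) (g ⟨$⟩ʳ j)
    gₖₗ = transpose (g ⟨$⟩ʳ k) (g ⟨$⟩ʳ l)

  ~-member : ∀ {x} → x ∈ Mem → (i , j) ~ (x ⟨$⟩ʳ i , x ⟨$⟩ʳ j)
  ~-member {i} {j} {x} x∈ = Mod.trans {transpose i j} {conjugate} {xᵢⱼ}
    (≋-conj-member x∈ (transpose i j)) (≈⇒≋ {conjugate} {xᵢⱼ} (transpose-conj x i j))
    where
    conjugate = (flip x ∘ₚ transpose i j) ∘ₚ x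
    xᵢⱼ = transpose (x ⟨$⟩ʳ i) (x ⟨$⟩ʳ j)

  shared-point : ∃[ a ] ∃[ b ] ∃[ c ] a ≢ b × a ≢ c × b ≢ c × (a , b) ~ (a , c)
  shared-point with i , xi≢i ← ¬∀⟶∃¬ n _ (λ i → x ⟨$⟩ʳ i ≟ i) (proj₂ (proj₂ nontrivial))
    with k , k∉ ← avoid (i ∷ (x ⟨$⟩ʳ i) ∷ []) (ℕ.≤-trans (ℕ.s≤s (ℕ.s≤s (ℕ.s≤s ℕ.z≤n))) 5≤n)
    with x ⟨$⟩ʳ k ≟ k
  -- If x fixes k, conjugating (i k) by x gives (x(i) k), and the two share k.
  ... | yes xk≡k = k , i , x ⟨$⟩ʳ i , k∉ ∘ here , k∉ ∘ there ∘ here , ≢-sym xi≢i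
      , ~-trans ~-swap (~-trans (subst (λ l → (i , k) ~ (x ⟨$⟩ʳ i , l)) xk≡k (~-member x∈)) ~-swap)
  ... | no xk≢k
    -- A fifth point e outside these four: conjugation by (k e) turns (i k) into (i e) and fixes
    -- (x(i) x(k)), so both are congruent to the latter.
    with e , e∉ ← avoid (i ∷ (x ⟨$⟩ʳ i) ∷ k ∷ (x ⟨$⟩ʳ k) ∷ []) 5≤n
    = i , k , e , ≢-sym (k∉ ∘ here) , ≢-sym (e∉ ∘ here) , ≢-sym (e∉ ∘ there ∘ there ∘ here)
    , ~-trans (~-member x∈) (~-sym (subst₂ _~_
        (cong₂ _,_ (transpose-fix (≢-sym (k∉ ∘ here)) (≢-sym (e∉ ∘ here))) (transpose-left k e))
        (cong₂ _,_ (transpose-fix (≢-sym (k∉ ∘ there ∘ here)) (≢-sym (e∉ ∘ there ∘ here)))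
                   (transpose-fix xk≢k (≢-sym (e∉ ∘ there ∘ there ∘ there ∘ here))))
        (~-map (transpose k e) (~-member x∈))))

  CongruentStar : Fin n → Set p
  CongruentStar a = ∀ {d e} → a ≢ d → a ≢ e → (a , d) ~ (a , e)

  -- For d other than b, conjugation by (c d) fixes a and b and carries (a c) to (a d), so (a b) is
  -- congruent to (a d).
  shared-point⇒star : ∀ {a b c} → a ≢ b → a ≢ c → b ≢ c → (a , b) ~ (a , c) → CongruentStar a
  shared-point⇒star {a} {b} {c} a≢b a≢c b≢c ab~ac a≢d a≢e =
    ~-trans (~-sym (spread _ a≢d)) (spread _ a≢e)
    where
    spread : ∀ d → a ≢ d → (a , b) ~ (a , d)
    spread d a≢d with d ≟ b
    ... | yes refl = Mod.refl {transpose a b}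
    ... | no  d≢b  = subst₂ _~_
      (cong₂ _,_ (transpose-fix a≢c a≢d) (transpose-fix b≢c (≢-sym d≢b)))
      (cong₂ _,_ (transpose-fix a≢c a≢d) (transpose-left c d))
      (~-map (transpose c d) ab~ac)

  -- Conjugation by (a b) carries the star at a to the star at b; since (a b) is an involution, its
  -- own images of d and e are the points to start from.
  star-everywhere : ∀ {a} → CongruentStar a → ∀ b → CongruentStar b
  star-everywhere {a} star b {d} {e} b≢d b≢e = subst₂ _~_
      (cong₂ _,_ (transpose-left a b) (transpose-involutive a b d))
      (cong₂ _,_ (transpose-left a b) (transpose-involutive a b e))
      (~-map (transpose a b) (star (moved b≢d) (moved b≢e)))
    where
    moved : ∀ {d} → b ≢ d → a ≢ transpose a b ⟨$⟩ʳ d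
    moved {d} b≢d a≡ = b≢d (perm-injective (transpose a b) (trans (transpose-right a b) a≡))

  transpositions-congruent : i ≢ j → k ≢ l → (i , j) ~ (k , l)
  transpositions-congruent {i} {j} {k} {l} i≢j k≢l
    with a , b , c , a≢b , a≢c , b≢c , ab~ac ← shared-point | i ≟ k
  ... | yes refl = star-everywhere (shared-point⇒star a≢b a≢c b≢c ab~ac) i i≢j k≢l
  -- The chain (i j), (i k), (k l) passes through a transposition common to both stars.
  ... | no  i≢k  = ~-trans (star i i≢j i≢k) (~-trans ~-swap (star k (≢-sym i≢k) k≢l))
    where
    star : ∀ b → CongruentStar b
    star = star-everywhere (shared-point⇒star a≢b a≢c b≢c ab~ac)

  module _ {q} (H : Subgroup (Sym n) q) {a b : Fin n} (a≢b : a ≢ b) (ab∈H : Transposes H a b) where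
    private
      module H = Subgroup H

    -- Each proper factor of a decomposition into transpositions is replaced by (a b) and each
    -- trivial factor is dropped, so the representative is a power of (a b).
    representative : ∀ π → ∃[ h ] h ∈ H.Mem × π ≋ h
    representative π = let h , h∈H , eval≋h = evaluated (decompose π) in
      h , h∈H , Mod.trans {π} {eval (decompose π)} {h}
          (≈⇒≋ {π} {eval (decompose π)} (λ i → sym (eval-decompose π i))) eval≋h
      where
      evaluated : ∀ ts → ∃[ h ] h ∈ H.Mem × eval ts ≋ h
      evaluated []             = Perm.id , H.ε∈ , Mod.refl {Perm.id}
      evaluated ((i , j) ∷ ts) with h , h∈H , ts≋h ← evaluated ts | i ≟ j
      ... | yes refl = h , h∈H
        , ≋-∘ {transpose i i} {Perm.id} {eval ts} {h}
            (≈⇒≋ {transpose i i} {Perm.id} (sym ∘ transpose-refl i)) ts≋h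
      ... | no  i≢j  = transpose a b ∘ₚ h , H.∙∈ ab∈H h∈H
        , ≋-∘ {transpose i j} {transpose a b} {eval ts} {h} (transpositions-congruent i≢j a≢b) ts≋h

    transitive : IsTransitiveSubgroup (rightMultiplication (Sym n) H) N
    transitive x y with h , h∈H , yx⁻¹≋h ← representative (y ∘ₚ flip x) =
      -- As h is congruent to y x⁻¹, the element h⁻¹ y x⁻¹ lies in N, and so does its conjugate f by
      -- x. Then x f y⁻¹ = h⁻¹ is in H, that is, Hxf = Hy.
      (flip x ∘ₚ (flip h ∘ₚ (y ∘ₚ flip x))) ∘ₚ x
      , normal x (resp {(flip h ∘ₚ ((y ∘ₚ flip x) ∘ₚ flip h)) ∘ₚ h} {flip h ∘ₚ (y ∘ₚ flip x)}
          (λ i → inverseʳ h) (normal h yx⁻¹≋h))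
      , H.resp (λ i → sym (trans (cong (y ⟨$⟩ˡ_) (inverseʳ x))
                      (trans (inverseˡ y) (cong (h ⟨$⟩ˡ_) (inverseˡ x)))))
               (H.⁻¹∈ h∈H)

-- Generated subgroups and subgroups preserving a labelling

⟨⟩-least : (G : Group c ℓ) {S : Pred (Group.Carrier G) p} (K : Subgroup G q) →
  S ⊆ Subgroup.Mem K → Generated G S ⊆ Subgroup.Mem K
⟨⟩-least G K S⊆K = go
  where
  open Subgroup K
  go : Generated G _ ⊆ Mem
  go (gen x∈S)     = S⊆K x∈S
  go unit          = ε∈
  go (mul x y)     = ∙∈ (go x) (go y)
  go (inv x)       = ⁻¹∈ (go x)
  go (congr x≈y x) = resp x≈y (go x)

preserving : ∀ {A : Set} → (Fin n → A) → Subgroup (Sym n) 0ℓ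
preserving f = record
  { Mem  = λ π → ∀ i → f (π ⟨$⟩ʳ i) ≡ f i
  ; resp = λ π≈ρ π∈ i → trans (cong f (sym (π≈ρ i))) (π∈ i)
  ; ε∈   = λ _ → refl
  ; ∙∈   = λ {π} π∈ ρ∈ i → trans (ρ∈ (π ⟨$⟩ʳ i)) (π∈ i)
  ; ⁻¹∈  = λ {π} π∈ i → trans (sym (π∈ (π ⟨$⟩ˡ i))) (cong f (inverseʳ π))
  }

transpose-preserves : ∀ {A : Set} (f : Fin n → A) {i j} → f i ≡ f j →
  transpose i j ∈ Subgroup.Mem (preserving f)
transpose-preserves f {i} {j} fi≡fj k = go (k ≟ i) (k ≟ j)
  where
  go : Dec (k ≡ i) → Dec (k ≡ j) → f (transpose i j ⟨$⟩ʳ k) ≡ f k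
  go (yes refl) _          = trans (cong f (transpose-left k j)) (sym fi≡fj)
  go (no _)     (yes refl) = trans (cong f (transpose-right i k)) fi≡fj
  go (no k≢i)   (no k≢j)   = cong f (transpose-fix k≢i k≢j)

toℕ-cycle⁻¹ : ∀ {N a} (i : Fin (suc N)) → toℕ i ≡ suc a → toℕ (cycle (suc N) ⟨$⟩ˡ i) ≡ a
toℕ-cycle⁻¹ (suc i) eq = trans (Fin.toℕ-inject₁ i) (ℕ.suc-injective eq)

-- The points, the cycle and generation of Sym(2m + 1)

-- deg = 2m + 1 with m = k + 2; the point a + 1 of {1, …, deg} is pt a.
module OddSym (k : ℕ) where
  m′ m N deg : ℕ
  m′ = suc k
  m  = suc m′
  N  = m + m
  deg = suc N

  -- Reduction modulo `deg` makes `pt` total, so points can be named without carrying a bound.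
  pt : ℕ → Fin deg
  pt a = a mod deg

  top : Fin deg
  top = pt N

  g : Permutation′ deg
  g = cycle deg

  H : Subgroup (Sym deg) 0ℓ
  H = ⟨_⟩ (Sym deg) (Swaps deg m)

  low<deg : ∀ {a} → a < m → a < deg
  low<deg a<m = ℕ.m≤n⇒m≤1+n (ℕ.m≤n⇒m≤n+o m a<m)

  high<deg : ∀ {a} → a < m → a + m < deg
  high<deg a<m = ℕ.m≤n⇒m≤1+n (ℕ.+-monoˡ-≤ m a<m)

  toℕ-pt : ∀ {a} → a < deg → toℕ (pt a) ≡ a
  toℕ-pt a<deg = trans (Fin.toℕ-fromℕ< _) (m<n⇒m%n≡m a<deg)

  pt-toℕ : ∀ i → pt (toℕ i) ≡ i
  pt-toℕ i = toℕ-injective (toℕ-pt (toℕ<n i))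

  pt-injective : ∀ {a b} → a < deg → b < deg → pt a ≡ pt b → a ≡ b
  pt-injective a<deg b<n eq = trans (sym (toℕ-pt a<deg)) (trans (cong toℕ eq) (toℕ-pt b<n))

  -- `cycle` defines its inverse by matching on the point itself, so these values are computed first
  -- and those of `g` follow by inversion.
  g⁻¹-pt : ∀ {a} → suc a < deg → g ⟨$⟩ˡ pt (suc a) ≡ pt a
  g⁻¹-pt {a} a+1<deg = toℕ-injective (trans
    (toℕ-cycle⁻¹ (pt (suc a)) (toℕ-pt a+1<deg)) (sym (toℕ-pt (ℕ.<-trans (ℕ.n<1+n a) a+1<deg))))

  g-pt : ∀ {a} → suc a < deg → g ⟨$⟩ʳ pt a ≡ pt (suc a)
  g-pt a+1<deg = trans (cong (g ⟨$⟩ʳ_) (sym (g⁻¹-pt a+1<deg))) (inverseʳ g)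

  g⁻¹-zero : g ⟨$⟩ˡ pt 0 ≡ top
  g⁻¹-zero = toℕ-injective (trans (Fin.toℕ-fromℕ N) (sym (toℕ-pt (ℕ.n<1+n N))))

  g-top : g ⟨$⟩ʳ top ≡ pt 0
  g-top = trans (cong (g ⟨$⟩ʳ_) (sym g⁻¹-zero)) (inverseʳ g)

  τ : ℕ → Permutation′ deg
  τ a = transpose (pt a) (pt (a + m))

  τ∈H : ∀ {a} → a < m → τ a ∈ Subgroup.Mem H
  τ∈H {a} a<m = gen (pt a , pt (a + m) , subst (_< m) (sym a≡) a<m
    , trans (toℕ-pt (high<deg a<m)) (cong (_+ m) (sym a≡)) , λ _ → refl)
    where a≡ = toℕ-pt (low<deg a<m)

  -- K contains (0, m) and, conjugating (m - 1, 2m - 1) twice by g, also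
  -- (m + 1, 0). Hence it contains (m, m + 1), whose conjugates under powers of g
  -- are the adjacent transpositions.
  generates : (K : Subgroup (Sym deg) q) → Subgroup.Mem H ⊆ Subgroup.Mem K → g ∈ Subgroup.Mem K →
    ∀ π → π ∈ Subgroup.Mem K
  generates K H⊆K g∈K = transpositions-generate K (λ i j → subst₂ T (pt-toℕ i) (pt-toℕ j)
    (T-trans (T-sym (from-zero (toℕ i) (toℕ<n i))) (from-zero (toℕ j) (toℕ<n j))))
    where
    open Subgroup K
    T = Transposes K
    T-sym : ∀ {i j} → T i j → T j i
    T-sym {i} {j} = Transposes-sym K {i = i} {j}
    T-trans : ∀ {i j k} → T i j → T j k → T i k
    T-trans {i} {j} {k} = Transposes-trans K {i = i} {j} {k}
    T-map : ∀ {π i j} → π ∈ Mem → T i j → T (π ⟨$⟩ʳ i) (π ⟨$⟩ʳ j)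
    T-map {π} {i} {j} = Transposes-map K {π = π} {i} {j}

    m<deg : m < deg
    m<deg = s≤s (ℕ.m≤m+n m m)

    suc-m<deg : suc m < deg
    suc-m<deg = s<s (ℕ.m<m+n m z<s)

    middle : T (pt m) (pt (suc m))
    middle = T-trans (T-sym (H⊆K (τ∈H z<s)))
      (T-sym (subst₂ T (g-pt suc-m<deg) g-top (T-map g∈K
        (subst₂ T (g-pt m<deg) (g-pt (ℕ.n<1+n N)) (T-map g∈K (H⊆K (τ∈H (ℕ.n<1+n m′))))))))

    back : ∀ a → suc a < deg → T (pt a) (pt (suc a)) → T (pt 0) (pt 1)
    back zero    _   t = t
    back (suc a) a<deg t =
      back a a+1<deg (subst₂ T (g⁻¹-pt a+1<deg) (g⁻¹-pt a<deg) (T-map (⁻¹∈ g∈K) t))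
      where a+1<deg = ℕ.<-trans (ℕ.n<1+n _) a<deg

    forward : ∀ a → suc a < deg → T (pt a) (pt (suc a))
    forward zero    _   = back m suc-m<deg middle
    forward (suc a) a<deg = subst₂ T (g-pt a+1<deg) (g-pt a<deg) (T-map g∈K (forward a a+1<deg))
      where a+1<deg = ℕ.<-trans (ℕ.n<1+n _) a<deg

    from-zero : ∀ a → a < deg → T (pt 0) (pt a)
    from-zero zero    _   = Transposes-refl K (pt 0)
    from-zero (suc a) a<deg = T-trans (from-zero a (ℕ.<-trans (ℕ.n<1+n a) a<deg)) (forward a a<deg)

  -- The blocks and their displacement by the cycle

  fold : ℕ → ℕ
  fold a with a ℕ.<? m
  ... | yes _ = a
  -- At a = 2m this is m, a label of its own, whereas reduction modulo m would put 2m with 0.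
  ... | no  _ = a ∸ m

  fold-low : ∀ {a} → a < m → fold a ≡ a
  fold-low {a} a<m with a ℕ.<? m
  ... | yes _   = refl
  ... | no  a≮m = contradiction a<m a≮m

  fold-high : ∀ a → fold (a + m) ≡ a
  fold-high a with a + m ℕ.<? m
  ... | yes a+m<m = contradiction a+m<m (ℕ.m+n≮n a m)
  ... | no  _     = ℕ.m+n∸n≡m a m

  block : Fin deg → ℕ
  block i = fold (toℕ i)

  -- block labels {a, a + m} (a < m) by a and {2m} by m.
  B : Subgroup (Sym deg) 0ℓ
  B = preserving block
  module B = Subgroup B

  Pair : Fin deg → Fin deg → Set
  Pair i j = ∃[ a ] a < m × i ≡ pt a × j ≡ pt (a + m)

  block-pt : ∀ {a} → a < m → block (pt a) ≡ block (pt (a + m))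
  block-pt {a} a<m = trans (trans (cong fold (toℕ-pt (low<deg a<m))) (fold-low a<m))
    (sym (trans (cong fold (toℕ-pt (high<deg a<m))) (fold-high a)))

  same-block : ∀ {i j} → block i ≡ block j → i ≡ j ⊎ Pair i j ⊎ Pair j i
  same-block {i} {j} eq with toℕ i ℕ.<? m | toℕ j ℕ.<? m
  ... | yes i<m | yes j<m = inj₁ (toℕ-injective eq)
  ... | yes i<m | no  j≮m = inj₂ (inj₁ (toℕ i , i<m , sym (pt-toℕ i) ,
    trans (sym (pt-toℕ j)) (cong pt (sym (trans (cong (_+ m) eq) (ℕ.m∸n+n≡m (ℕ.≮⇒≥ j≮m)))))))
  ... | no  i≮m | yes j<m = inj₂ (inj₂ (toℕ j , j<m , sym (pt-toℕ j) ,
    trans (sym (pt-toℕ i)) (cong pt (sym (trans (cong (_+ m) (sym eq)) (ℕ.m∸n+n≡m (ℕ.≮⇒≥ i≮m)))))))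
  ... | no  i≮m | no  j≮m = inj₁ (toℕ-injective (ℕ.∸-cancelʳ-≡ (ℕ.≮⇒≥ i≮m) (ℕ.≮⇒≥ j≮m) eq))

  Pair-irreflexive : ∀ {i} → ¬ Pair i i
  Pair-irreflexive (a , a<m , refl , eq) =
    ℕ.m≢1+m+n a (trans (pt-injective (low<deg a<m) (high<deg a<m) eq) (ℕ.+-suc a m′))

  image : ∀ π → π ∈ B.Mem → ∀ i → π ⟨$⟩ʳ i ≡ i ⊎ Pair i (π ⟨$⟩ʳ i) ⊎ Pair (π ⟨$⟩ʳ i) i
  image π π∈B i with same-block (π∈B i)
  ... | inj₁ eq               = inj₁ eq
  ... | inj₂ (inj₁ πi,i)      = inj₂ (inj₂ πi,i)
  ... | inj₂ (inj₂ i,πi)      = inj₂ (inj₁ i,πi)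

  fixes-top : ∀ π → π ∈ B.Mem → π ⟨$⟩ʳ top ≡ top
  fixes-top π π∈B with image π π∈B top
  ... | inj₁ eq                        = eq
  ... | inj₂ (inj₁ (a , a<m , eq , _)) =
    contradiction (subst (_< m) (sym (pt-injective (ℕ.n<1+n N) (low<deg a<m) eq)) a<m) (ℕ.m+n≮n m m)
  ... | inj₂ (inj₂ (a , a<m , _ , eq)) =
    contradiction (ℕ.+-cancelʳ-≡ m m a (pt-injective (ℕ.n<1+n N) (high<deg a<m) eq))
      (ℕ.<⇒≢ a<m ∘ sym)

  image-low : ∀ π {a} → π ∈ B.Mem → a < m → π ⟨$⟩ʳ pt a ≡ pt a ⊎ π ⟨$⟩ʳ pt a ≡ pt (a + m)
  image-low π {a} π∈B a<m with image π π∈B (pt a)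
  ... | inj₁ eq = inj₁ eq
  ... | inj₂ (inj₁ (b , b<m , eq , πa≡)) =
    inj₂ (trans πa≡ (cong (λ c → pt (c + m)) (sym (pt-injective (low<deg a<m) (low<deg b<m) eq))))
  ... | inj₂ (inj₂ (b , b<m , _ , eq)) =
    contradiction (subst (_< m) (pt-injective (low<deg a<m) (high<deg b<m) eq) a<m) (ℕ.m+n≮n b m)

  -- Only the pair with lower point z may be split by σ. As π fixes z, it does not swap that pair,
  -- and σ carries every pair that π does swap into one block.
  conjugate∈B : ∀ σ π {z} → (∀ {i j} → Pair i j → i ≢ z → block (σ ⟨$⟩ʳ i) ≡ block (σ ⟨$⟩ʳ j)) →
    π ∈ B.Mem → π ⟨$⟩ʳ z ≡ z → (flip σ ∘ₚ π) ∘ₚ σ ∈ B.Mem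
  conjugate∈B σ π {z} keeps π∈B πz≡z i = trans (moved (image π π∈B i′)) (cong block (inverseʳ σ))
    where
    i′ = σ ⟨$⟩ˡ i
    moved : π ⟨$⟩ʳ i′ ≡ i′ ⊎ Pair i′ (π ⟨$⟩ʳ i′) ⊎ Pair (π ⟨$⟩ʳ i′) i′ →
      block (σ ⟨$⟩ʳ (π ⟨$⟩ʳ i′)) ≡ block (σ ⟨$⟩ʳ i′)
    moved (inj₁ πi≡i)          = cong (block ∘ (σ ⟨$⟩ʳ_)) πi≡i
    moved (inj₂ (inj₁ i,πi)) = sym (keeps i,πi λ i≡z →
      Pair-irreflexive (subst₂ Pair i≡z (trans (cong (π ⟨$⟩ʳ_) i≡z) πz≡z) i,πi))
    moved (inj₂ (inj₂ πi,i)) = keeps πi,i λ πi≡z →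
      Pair-irreflexive (subst₂ Pair πi≡z (perm-injective π (trans πi≡z (sym πz≡z))) πi,i)

  -- For a > 0 the pair (a, a + m) is lowered to (a - 1, a - 1 + m). The excluded pair (0, m) goes
  -- to (2m, m - 1).
  g⁻¹-keeps : ∀ {i j} → Pair i j → i ≢ pt 0 → block (g ⟨$⟩ˡ i) ≡ block (g ⟨$⟩ˡ j)
  g⁻¹-keeps (zero  , a<m , refl , refl) i≢0 = contradiction refl i≢0
  g⁻¹-keeps (suc a , a<m , refl , refl) i≢0 = subst₂ (λ i j → block i ≡ block j)
    (sym (g⁻¹-pt (low<deg a<m))) (sym (g⁻¹-pt (high<deg a<m)))
    (block-pt (ℕ.<-trans (ℕ.n<1+n a) a<m))

  -- Here the excluded pair is (m - 1, 2m - 1), which goes to (m, 2m).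
  g-keeps : ∀ {i j} → Pair i j → i ≢ pt m′ → block (g ⟨$⟩ʳ i) ≡ block (g ⟨$⟩ʳ j)
  g-keeps (a , a<m , refl , refl) i≢m′ = subst₂ (λ i j → block i ≡ block j)
    (sym (g-pt (low<deg a+1<m))) (sym (g-pt (high<deg a+1<m))) (block-pt a+1<m)
    where a+1<m = s<s (ℕ.≤∧≢⇒< (s≤s⁻¹ a<m) (i≢m′ ∘ cong pt))

  τ∈B : ∀ {a} → a < m → τ a ∈ B.Mem
  τ∈B a<m = transpose-preserves block (block-pt a<m)

  H⊆B : Subgroup.Mem H ⊆ B.Mem
  H⊆B = ⟨⟩-least (Sym deg) B λ { {π} (i , j , i<m , j≡ , π≈) →
    B.resp {transpose i j} {π} (sym ∘ π≈) (transpose-preserves block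
      (trans (cong block (sym (pt-toℕ i)))
        (trans (block-pt i<m) (cong block (trans (cong pt (sym j≡)) (pt-toℕ j)))))) }

  -- Enumeration of H by binary digits

  choose : Fin 2 → Permutation′ deg → Permutation′ deg
  choose 0F π = Perm.id
  choose 1F π = π

  digit : ∀ {l} → Fin (2 ^ suc l) → Fin 2
  digit {l} a = proj₁ (remQuot {2} (2 ^ l) a)

  rest : ∀ {l} → Fin (2 ^ suc l) → Fin (2 ^ l)
  rest {l} a = proj₂ (remQuot {2} (2 ^ l) a)

  -- Numbers the elements of H moving only pt a and pt (a + m) with a < l.
  element : ∀ l → Fin (2 ^ l) → Permutation′ deg
  element zero    _ = Perm.id
  element (suc l) a = element l (rest {l} a) ∘ₚ choose (digit {l} a) (τ l)

  element∈H : ∀ {l} → l ≤ m → ∀ a → element l a ∈ Subgroup.Mem H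
  element∈H {zero}  _   a = unit
  element∈H {suc l} l<m a = mul (element∈H (ℕ.<⇒≤ l<m) _) (choose∈H (digit {l} a))
    where
    choose∈H : ∀ b → choose b (τ l) ∈ Subgroup.Mem H
    choose∈H 0F = unit
    choose∈H 1F = τ∈H l<m

  τ-fixes : ∀ {l a} → l < a → a < m → τ l ⟨$⟩ʳ pt a ≡ pt a
  τ-fixes {l} {a} l<a a<m = transpose-fix
    (ℕ.<⇒≢ l<a ∘ sym ∘ pt-injective (low<deg a<m) (low<deg l<m))
    (ℕ.<⇒≢ (ℕ.<-≤-trans a<m (ℕ.m≤n+m m l)) ∘ pt-injective (low<deg a<m) (high<deg l<m))
    where l<m = ℕ.<-trans l<a a<m

  element-fixes : ∀ l b {a} → l ≤ a → a < m → element l b ⟨$⟩ʳ pt a ≡ pt a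
  element-fixes zero    b _   _   = refl
  element-fixes (suc l) b {a} l<a a<m =
    trans (cong (choose d (τ l) ⟨$⟩ʳ_) (element-fixes l _ (ℕ.<⇒≤ l<a) a<m)) (choose-fixes d)
    where
    d = digit {l} b
    choose-fixes : ∀ d → choose d (τ l) ⟨$⟩ʳ pt a ≡ pt a
    choose-fixes 0F = refl
    choose-fixes 1F = τ-fixes l<a a<m

  -- The factors below l fix `pt l`, so the image of `pt l` reveals the leading digit; cancelling
  -- the last factor leaves shorter products.
  element-injective : ∀ {l} → l ≤ m → ∀ {a b} → element l a Perm.≈ element l b → a ≡ b
  element-injective {zero}  _   {0F} {0F} _ = refl
  element-injective {suc l} l<m {a}  {b}  eq =
    trans (sym (Fin.combine-remQuot {2} (2 ^ l) a))
      (trans (cong₂ combine digits rests) (Fin.combine-remQuot {2} (2 ^ l) b))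
    where
    digit-injective : ∀ {d e} → choose d (τ l) ⟨$⟩ʳ pt l ≡ choose e (τ l) ⟨$⟩ʳ pt l → d ≡ e
    digit-injective {0F} {0F} _ = refl
    digit-injective {1F} {1F} _ = refl
    digit-injective {0F} {1F} eq =
      contradiction (l , l<m , refl , trans eq (transpose-left (pt l) (pt (l + m))))
        Pair-irreflexive
    digit-injective {1F} {0F} eq =
      contradiction (l , l<m , refl , trans (sym eq) (transpose-left (pt l) (pt (l + m))))
        Pair-irreflexive

    value : ∀ a → element (suc l) a ⟨$⟩ʳ pt l ≡ choose (digit {l} a) (τ l) ⟨$⟩ʳ pt l
    value a = cong (choose (digit {l} a) (τ l) ⟨$⟩ʳ_) (element-fixes l _ ℕ.≤-refl l<m)

    digits : digit {l} a ≡ digit {l} b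
    digits = digit-injective (trans (sym (value a)) (trans (eq (pt l)) (value b)))

    rests : rest {l} a ≡ rest {l} b
    rests = element-injective (ℕ.<⇒≤ l<m) λ i → perm-injective (choose (digit {l} b) (τ l))
      (trans (cong (λ d → choose d (τ l) ⟨$⟩ʳ (element l (rest {l} a) ⟨$⟩ʳ i)) (sym digits)) (eq i))

  element-combine : ∀ l d a → element l a ∘ₚ choose d (τ l) Perm.≈ element (suc l) (combine d a)
  element-combine l d a i =
    cong (λ (e , b) → choose e (τ l) ⟨$⟩ʳ (element l b ⟨$⟩ʳ i)) (sym (Fin.remQuot-combine {2} d a))

  -- The hypothesis `fixes` confines π to the pairs below l. In the inductive step, if π moves
  -- `pt l` it maps it to its partner, and multiplying by `τ l` makes `pt l` fixed again.
  element-surjective : ∀ {l} → l ≤ m → ∀ π → π ∈ B.Mem →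
    (∀ {a} → l ≤ a → a < m → π ⟨$⟩ʳ pt a ≡ pt a) →
    ∃[ a ] π Perm.≈ element l a
  element-surjective {zero} _ π π∈B fixes = 0F , λ i → fixed i (image π π∈B i)
    where
    fixed : ∀ i → π ⟨$⟩ʳ i ≡ i ⊎ Pair i (π ⟨$⟩ʳ i) ⊎ Pair (π ⟨$⟩ʳ i) i → π ⟨$⟩ʳ i ≡ i
    fixed i (inj₁ eq) = eq
    fixed i (inj₂ (inj₁ (a , a<m , refl , _)))  = fixes z≤n a<m
    fixed i (inj₂ (inj₂ (a , a<m , πi≡a , _)))  =
      perm-injective π (trans (cong (π ⟨$⟩ʳ_) πi≡a) (trans (fixes z≤n a<m) (sym πi≡a)))
  element-surjective {suc l} l<m π π∈B fixes with image-low π π∈B l<m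
  ... | inj₁ fixes-l = let a , eq = element-surjective (ℕ.<⇒≤ l<m) π π∈B fixes′ in
    combine {2} 0F a , λ i → trans (eq i) (element-combine l 0F a i)
    where
    fixes′ : ∀ {a} → l ≤ a → a < m → π ⟨$⟩ʳ pt a ≡ pt a
    fixes′ {a} l≤a a<m with l ℕ.≟ a
    ... | yes refl = fixes-l
    ... | no  l≢a  = fixes (ℕ.≤∧≢⇒< l≤a l≢a) a<m
  ... | inj₂ moves-l =
    let a , eq = element-surjective (ℕ.<⇒≤ l<m) (π ∘ₚ τ l) (B.∙∈ {π} {τ l} π∈B (τ∈B l<m)) fixes′ in
    combine {2} 1F a , λ i → trans (sym (transpose-involutive (pt l) (pt (l + m)) _))
      (trans (cong (τ l ⟨$⟩ʳ_) (eq i)) (element-combine l 1F a i))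
    where
    fixes′ : ∀ {a} → l ≤ a → a < m → τ l ⟨$⟩ʳ (π ⟨$⟩ʳ pt a) ≡ pt a
    fixes′ {a} l≤a a<m with l ℕ.≟ a
    ... | yes refl = trans (cong (τ l ⟨$⟩ʳ_) moves-l) (transpose-right (pt a) (pt (a + m)))
    ... | no  l≢a  =
      trans (cong (τ l ⟨$⟩ʳ_) (fixes (ℕ.≤∧≢⇒< l≤a l≢a) a<m)) (τ-fixes (ℕ.≤∧≢⇒< l≤a l≢a) a<m)

  element-exhausts : ∀ π → π ∈ B.Mem → ∃[ a ] π Perm.≈ element m a
  element-exhausts π π∈B =
    element-surjective ℕ.≤-refl π π∈B (λ m≤a a<m → contradiction a<m (ℕ.≤⇒≯ m≤a))

  private
    module H = Subgroup H

  -- With `H⊆B` this identifies H as the stabiliser of the blocks, so membership in H can be tested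
  -- on points.
  B⊆H : B.Mem ⊆ H.Mem
  B⊆H {π} π∈B = let a , eq = element-exhausts π π∈B in
    H.resp {element m a} {π} (sym ∘ eq) (element∈H ℕ.≤-refl a)

  -- The coset graph, its double cosets and its valency

  Γ : Graph 0ℓ 0ℓ 0ℓ
  Γ = Cos (Sym deg) H g

  α : RightAction (Sym deg) (rightCosets (Sym deg) H)
  α = rightMultiplication (Sym deg) H

  D : Pred (Permutation′ deg) 0ℓ
  D = DoubleCoset (Sym deg) H g

  infix 4 _≡H_
  _≡H_ : Permutation′ deg → Permutation′ deg → Set
  u ≡H v = u ∘ₚ flip v ∈ H.Mem

  -- Every element of H fixes top.
  ≡H⇒top : ∀ u v → u ≡H v → u ⟨$⟩ʳ top ≡ v ⟨$⟩ʳ top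
  ≡H⇒top u v uv⁻¹∈H =
    trans (sym (inverseʳ v)) (cong (v ⟨$⟩ʳ_) (fixes-top (u ∘ₚ flip v) (H⊆B uv⁻¹∈H)))

  -- Here σ⁻¹ may split only the pair of `pt a`. If k fixes `pt a`, then σ k σ⁻¹ preserves the
  -- blocks and u lies in Hσ; otherwise k times the inverse of `τ a` fixes `pt a`, and the same
  -- argument puts u in the other coset.
  classify : ∀ σ {a} → a < m →
    (∀ {i j} → Pair i j → i ≢ pt a → block (σ ⟨$⟩ˡ i) ≡ block (σ ⟨$⟩ˡ j)) →
    ∀ u h k → h ∈ H.Mem → k ∈ H.Mem → u Perm.≈ (h ∘ₚ σ) ∘ₚ k → u ≡H σ ⊎ u ≡H σ ∘ₚ τ a
  classify σ {a} a<m keeps u h k h∈H k∈H u≈hσk with image-low k (H⊆B k∈H) a<m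
  ... | inj₁ k-fixes = inj₁ (H.resp {h ∘ₚ ((σ ∘ₚ k) ∘ₚ flip σ)} {u ∘ₚ flip σ}
    (λ i → cong (σ ⟨$⟩ˡ_) (sym (u≈hσk i)))
    (H.∙∈ {h} {(σ ∘ₚ k) ∘ₚ flip σ} h∈H (B⊆H {(σ ∘ₚ k) ∘ₚ flip σ}
      (conjugate∈B (flip σ) k keeps (H⊆B k∈H) k-fixes))))
  ... | inj₂ k-moves = inj₂ (H.resp {h ∘ₚ ((σ ∘ₚ kτ⁻¹) ∘ₚ flip σ)} {u ∘ₚ flip (σ ∘ₚ τ a)}
    (λ i → cong (λ j → σ ⟨$⟩ˡ (τ a ⟨$⟩ˡ j)) (sym (u≈hσk i)))
    (H.∙∈ {h} {(σ ∘ₚ kτ⁻¹) ∘ₚ flip σ} h∈H (B⊆H {(σ ∘ₚ kτ⁻¹) ∘ₚ flip σ}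
      (conjugate∈B (flip σ) kτ⁻¹ keeps
      (B.∙∈ {k} {flip (τ a)} (H⊆B k∈H) (B.⁻¹∈ {τ a} (τ∈B a<m)))
      (trans (cong (τ a ⟨$⟩ˡ_) k-moves) (transpose-left (pt (a + m)) (pt a)))))))
    where kτ⁻¹ = k ∘ₚ flip (τ a)

  classify-out : ∀ u → u ∈ D → u ≡H g ⊎ u ≡H g ∘ₚ τ 0
  classify-out u (h , k , h∈H , k∈H , u≈) = classify g z<s g⁻¹-keeps u h k h∈H k∈H u≈

  -- u⁻¹ = h g k means u = k⁻¹ g⁻¹ h⁻¹, and the pair that g splits is that of `pt m′`.
  classify-in : ∀ u → flip u ∈ D → u ≡H flip g ⊎ u ≡H flip g ∘ₚ τ m′
  classify-in u (h , k , h∈H , k∈H , u⁻¹≈) =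
    classify (flip g) (ℕ.n<1+n m′) g-keeps u (flip k) (flip h) (H.⁻¹∈ k∈H) (H.⁻¹∈ h∈H)
      (Group.⁻¹-cong (Sym deg) {flip u} {(h ∘ₚ g) ∘ₚ k} u⁻¹≈)

  -- Representatives of the cosets in HgH and Hg⁻¹H, listed by increasing image of `top` so that
  -- monotonicity separates them.
  neighbour : Fin 4 → Permutation′ deg
  neighbour 0F = g
  neighbour 1F = flip g ∘ₚ τ m′
  neighbour 2F = g ∘ₚ τ 0
  neighbour 3F = flip g

  height : Fin 4 → ℕ
  height 0F = 0
  height 1F = m′
  height 2F = m
  height 3F = m′ + m

  neighbour-top : ∀ a → neighbour a ⟨$⟩ʳ top ≡ pt (height a)
  neighbour-top 0F = g-top
  neighbour-top 1F =
    trans (cong (τ m′ ⟨$⟩ʳ_) (g⁻¹-pt (ℕ.n<1+n N))) (transpose-right (pt m′) (pt (m′ + m)))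
  neighbour-top 2F = trans (cong (τ 0 ⟨$⟩ʳ_) g-top) (transpose-left (pt 0) (pt m))
  neighbour-top 3F = g⁻¹-pt (ℕ.n<1+n N)

  height<deg : ∀ a → height a < deg
  height<deg 0F = z<s
  height<deg 1F = low<deg (ℕ.n<1+n m′)
  height<deg 2F = high<deg z<s
  height<deg 3F = high<deg (ℕ.n<1+n m′)

  height-mono : ∀ {a b} → a Fin.< b → height a < height b
  -- `m′` is a successor, that is, m is at least 2; comparing `2F` with `3F` relies on this too.
  height-mono {0F} {1F} _ = z<s
  height-mono {0F} {2F} _ = z<s
  height-mono {0F} {3F} _ = z<s
  height-mono {1F} {2F} _ = ℕ.n<1+n m′
  height-mono {1F} {3F} _ = ℕ.m<m+n m′ z<s
  height-mono {2F} {3F} _ = ℕ.m<n+m m z<s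
  height-mono {2F} {2F} a<b = contradiction a<b (ℕ.<-irrefl refl)
  height-mono {1F} {1F} a<b = contradiction a<b (ℕ.<-irrefl refl)
  height-mono {3F} {1F} (s≤s ())
  height-mono {3F} {2F} (s≤s (s≤s ()))
  height-mono {3F} {3F} a<b = contradiction a<b (ℕ.<-irrefl refl)
  height-mono {2F} {1F} (s≤s ())

  height-injective : ∀ {a b} → height a ≡ height b → a ≡ b
  height-injective {a} {b} eq with Fin.<-cmp a b
  ... | tri< a<b _ _ = contradiction eq (ℕ.<⇒≢ (height-mono a<b))
  ... | tri≈ _ a≡b _ = a≡b
  ... | tri> _ _ b<a = contradiction (sym eq) (ℕ.<⇒≢ (height-mono b<a))

  neighbour-injective : ∀ {a b} → neighbour a ⟨$⟩ʳ top ≡ neighbour b ⟨$⟩ʳ top → a ≡ b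
  neighbour-injective {a} {b} eq = height-injective (pt-injective (height<deg a) (height<deg b)
    (trans (sym (neighbour-top a)) (trans eq (neighbour-top b))))

  -- Otherwise u would lie in a coset of HgH and in one of Hg⁻¹H, whose images of `top` differ. The
  -- case u = 1 also rules out loops.
  D-antisymmetric : ∀ u → u ∈ D → ¬ flip u ∈ D
  D-antisymmetric u u∈D u⁻¹∈D = go (classify-out u u∈D) (classify-in u u⁻¹∈D)
    where
    agree : ∀ a b → u ≡H neighbour a → u ≡H neighbour b → a ≡ b
    agree a b ua ub = neighbour-injective
      (trans (sym (≡H⇒top u (neighbour a) ua)) (≡H⇒top u (neighbour b) ub))
    go : u ≡H g ⊎ u ≡H g ∘ₚ τ 0 → ¬ (u ≡H flip g ⊎ u ≡H flip g ∘ₚ τ m′)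
    go (inj₁ out) (inj₁ in′) with () ← agree 0F 3F out in′
    go (inj₁ out) (inj₂ in′) with () ← agree 0F 1F out in′
    go (inj₂ out) (inj₁ in′) with () ← agree 2F 3F out in′
    go (inj₂ out) (inj₂ in′) with () ← agree 2F 1F out in′

  neighbour-arc : ∀ a → neighbour a ∈ D ⊎ flip (neighbour a) ∈ D
  neighbour-arc 0F = inj₁ (Perm.id , Perm.id , H.ε∈ , H.ε∈ , λ _ → refl)
  neighbour-arc 1F = inj₂ (flip (τ m′) , Perm.id , H.⁻¹∈ (τ∈H (ℕ.n<1+n m′)) , H.ε∈ , λ _ → refl)
  neighbour-arc 2F = inj₁ (Perm.id , τ 0 , H.ε∈ , τ∈H z<s , λ _ → refl)
  neighbour-arc 3F = inj₂ (Perm.id , Perm.id , H.ε∈ , H.ε∈ , λ _ → refl)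

  module Coset = CosetGraph (Sym deg) H g

  valency : Graph.HasValency Γ 4
  valency x = hasSize (subset (rightCosets (Sym deg) H) (Graph._~_ Γ x))
    -- Right multiplication by x carries the neighbours of H to those of Hx.
    (λ a → neighbour a ∘ₚ x , adjacent a)
    (λ {a} {b} eq → neighbour-injective (perm-injective x
      (≡H⇒top (neighbour a ∘ₚ x) (neighbour b ∘ₚ x) eq)))
    (λ (y , x~y) → numbered y x~y)
    where
    adjacent : ∀ a → Graph._~_ Γ x (neighbour a ∘ₚ x)
    adjacent a = Sum.swap (Sum.map
      (Coset.∈D-resp {neighbour a} {(neighbour a ∘ₚ x) ∘ₚ flip x} (λ i → sym (inverseˡ x)))
      (Coset.∈D-resp {flip (neighbour a)} {x ∘ₚ flip (neighbour a ∘ₚ x)}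
        (λ i → cong (neighbour a ⟨$⟩ˡ_) (sym (inverseˡ x))))
      (neighbour-arc a))
    numbered : ∀ y → Graph._~_ Γ x y → ∃[ a ] y ≡H neighbour a ∘ₚ x
    numbered y (inj₁ xy⁻¹∈D) = Sum.[ (3F ,_) , (1F ,_) ] (classify-in (y ∘ₚ flip x) xy⁻¹∈D)
    numbered y (inj₂ yx⁻¹∈D) = Sum.[ (0F ,_) , (2F ,_) ] (classify-out (y ∘ₚ flip x) yx⁻¹∈D)

  -- Finiteness, faithfulness, quasiprimitivity and stabilisers

  _≡H?_ : ∀ u v → Dec (u ≡H v)
  -- Preserving the blocks is a condition on finitely many points, hence decidable.
  u ≡H? v = Dec.map′ B⊆H H⊆B (all? λ i → block ((u ∘ₚ flip v) ⟨$⟩ʳ i) ℕ.≟ block i)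

  cosets : DecSetoid 0ℓ 0ℓ
  cosets = record { isDecEquivalence = record
    { isEquivalence = Setoid.isEquivalence (rightCosets (Sym deg) H) ; _≟_ = _≡H?_ } }

  finite : IsFinite (rightCosets (Sym deg) H)
  finite = enumerated⇒finite cosets λ π →
    Any.map (λ {ρ} → Coset.≈⇒C≈ {π} {ρ}) (permutations-enumerates deg π)

  -- The image of `top` is constant on each coset of H, and on the coset of the transposition (top
  -- i) it is i; so f must fix i.
  faithful : IsFaithful α
  faithful f fixes i = subst (λ j → f ⟨$⟩ʳ j ≡ j) (transpose-left top i)
    (≡H⇒top (transpose top i ∘ₚ f) (transpose top i) (fixes (transpose top i)))

  og4 : OG4 Γ (Sym deg) α
  og4 = record
    { finite           = finite
    ; loopless         = Coset.loopless λ id∈D → D-antisymmetric Perm.id id∈D id∈D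
    ; connected        = Coset.connected generates
    ; valency          = valency
    ; automorphisms    = Coset.automorphisms
    ; faithful         = faithful
    ; vertexTransitive = Coset.vertexTransitive
    ; edgeTransitive   = λ {x} {y} {x′} {y′} → Coset.edgeTransitive {x} {y} {x′} {y′}
    ; oriented         = Coset.oriented D-antisymmetric
    }

  quasiprimitive : IsQuasiprimitive α p
  quasiprimitive N normal nontrivial =
    NormalSubgroup.transitive 5≤deg N normal nontrivial H 0≢m (τ∈H z<s)
    where
    5≤deg : 5 ≤ deg
    5≤deg = s≤s (s≤s (s≤s (ℕ.≤-trans (s≤s (s≤s z≤n)) (ℕ.m≤n+m m k))))

    0≢m : pt 0 ≢ pt m
    0≢m eq = contradiction (pt-injective z<s (height<deg 2F) eq) λ ()

  -- The stabiliser of Hx is x⁻¹ H x, so conjugating the numbered elements of H by x lists it.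
  stabiliser-size : ∀ x → HasSize (stabiliser α x) (2 ^ m)
  stabiliser-size x = hasSize (stabiliser α x)
    (λ a → (flip x ∘ₚ element m a) ∘ₚ x
         , H.resp {element m a}
             (λ i → sym (trans (inverseˡ x) (cong (element m a ⟨$⟩ʳ_) (inverseˡ x))))
             (element∈H ℕ.≤-refl a))
    (λ {a} {b} eq → element-injective ℕ.≤-refl λ i → perm-injective x
      (subst (λ j → x ⟨$⟩ʳ (element m a ⟨$⟩ʳ j) ≡ x ⟨$⟩ʳ (element m b ⟨$⟩ʳ j))
        (inverseˡ x) (eq (x ⟨$⟩ʳ i))))
    numbered
    where
    numbered : ((f , _) : ∃[ f ] x ∘ₚ f ≡H x) → ∃[ a ] f Perm.≈ (flip x ∘ₚ element m a) ∘ₚ x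
    numbered (f , xfx⁻¹∈H) =
      let a , eq = element-exhausts ((x ∘ₚ f) ∘ₚ flip x) (H⊆B xfx⁻¹∈H)
      in a , λ i → trans (sym (trans (inverseʳ x) (cong (f ⟨$⟩ʳ_) (inverseʳ x))))
                      (cong (x ⟨$⟩ʳ_) (eq (x ⟨$⟩ˡ i)))

-- From n = 2m + 1 to odd n

odd-case : ∀ p n m → 2 ≤ m → n ≡ suc (m + m) →
  let G = Sym n
      H = ⟨_⟩ G (Swaps n m)
      α = rightMultiplication G H
  in IsBasicQuasiprimitive (Cos G H (cycle n)) G α p × (∀ x → HasSize (stabiliser α x) (2 ^ m))
-- Matching on the bound and the equation leaves m = k + 2 and n = 2m + 1, the setting of `OddSym`.
odd-case p n (suc (suc k)) (s≤s (s≤s _)) refl =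
  record { og4 = og4 ; quasiprimitive = quasiprimitive } , stabiliser-size
  where open OddSym k

lemma5p4 : (p : Level) (n : ℕ) → 5 ≤ n → n % 2 ≡ 1 →
    let m = (n ∸ 1) / 2
        G = Sym n
        H = ⟨_⟩ G (Swaps n m)
        g = cycle n
        Γ = Cos G H g
        α = rightMultiplication G H
    in IsBasicQuasiprimitive Γ G α p
       × (∀ x → HasSize (stabiliser α x) (2 ^ m))
-- The bound 2 ≤ m is (5 - 1) / 2 ≤ (n - 1) / 2, by monotonicity.
lemma5p4 p n 5≤n n%2≡1 = odd-case p n ((n ∸ 1) / 2) (/-monoˡ-≤ 2 (ℕ.∸-monoˡ-≤ 1 5≤n)) n≡1+2m
  where
  n≡1+[n/2]2 : n ≡ 1 + n / 2 * 2
  n≡1+[n/2]2 = trans (m≡m%n+[m/n]*n n 2) (cong (_+ n / 2 * 2) n%2≡1)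

  -- As n is odd, n - 1 is twice n / 2, so halving it is exact.
  m≡n/2 : (n ∸ 1) / 2 ≡ n / 2
  m≡n/2 = trans (cong (λ l → (l ∸ 1) / 2) n≡1+[n/2]2) (m*n/n≡m (n / 2) 2)

  n≡1+2m : n ≡ suc ((n ∸ 1) / 2 + (n ∸ 1) / 2)
  n≡1+2m = trans n≡1+[n/2]2 (cong suc (trans (cong (_* 2) (sym m≡n/2))
    (trans (ℕ.*-comm ((n ∸ 1) / 2) 2) (cong ((n ∸ 1) / 2 +_) (ℕ.+-identityʳ _)))))
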